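{- If a judgement $\Gamma\vdash\mathbf t:T$ is derivable in the system Additive, then there is a term $t'$ of System $F$ with pairs such that $|\Gamma|\vdash_F t':|T|$ is derivable.
   Context: Language. Terms and values: $\mathbf t,\mathbf u ::= \mathbf v \mid \mathbf t\,\mathbf u \mid \mathbf t+\mathbf u \mid \mathbf 0$; $\mathbf v ::= x \mid \lambda x.\mathbf t$. Terms are considered up to $\alpha$-conversion and modulo associativity and commutativity of $+$. Types of the system Additive. Types $T,R,S ::= U \mid T+R \mid \overline 0$; unit types $U,V,W ::= X \mid U\to T \mid \forall X.U$ (with $X$ a type variable). $T[U/X]$ is capture-avoiding substitution of a unit type for a type variable, and $T[\vec U/\vec X]$ stands for $T[U_1/X_1]\cdots[U_n/X_n]$ (where $X_i$ is not free in $U_j$ for $j<i$). $\equiv$ is the least congruence on types with $T+R\equiv R+T$, $T+(R+S)\equiv(T+R)+S$, $T+\overline 0\equiv T$. Notation: $\sum_{i=1}^{0}T_i=\overline 0$ and $\sum_{i=1}^{\alpha}T_i=\sum_{i=1}^{\alpha-1}T_i+T_\alpha$ for $\alpha\ge 1$. A context $\Gamma$ is a set of pairs $x:U$ ($U$ a unit type) with each term variable appearing at most once; $FV(\Gamma)$ is its set of free type variables. Typing rules of Additive: (ax) $\Gamma,x:U\vdash x:U$. (ax$_{\overline 0}$) $\Gamma\vdash\mathbf 0:\overline 0$. ($\equiv$) from $\Gamma\vdash\mathbf t:T$ and $T\equiv R$ infer $\Gamma\vdash\mathbf t:R$. ($\to_I$) from $\Gamma,x:U\vdash\mathbf t:T$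 infer $\Gamma\vdash\lambda x.\mathbf t:U\to T$. ($\to_E$) from $\Gamma\vdash\mathbf t:\sum_{i=1}^{\alpha}\forall\vec X.(U\to T_i)$ and $\Gamma\vdash\mathbf u:\sum_{j=1}^{\beta}U[\vec V_j/\vec X]$ infer $\Gamma\vdash\mathbf t\mathbf u:\sum_{i=1}^{\alpha}\sum_{j=1}^{\beta}T_i[\vec V_j/\vec X]$. ($+_I$) from $\Gamma\vdash\mathbf t:T$ and $\Gamma\vdash\mathbf u:R$ infer $\Gamma\vdash\mathbf t+\mathbf u:T+R$. ($\forall_E$) from $\Gamma\vdash\mathbf t:\forall X.U$ infer $\Gamma\vdash\mathbf t:U[V/X]$ ($V$ a unit type). ($\forall_I$) from $\Gamma\vdash\mathbf t:U$ and $X\notin FV(\Gamma)$ infer $\Gamma\vdash\mathbf t:\forall X.U$. System $F$ with pairs (Curry style). Terms: $t,u ::= x \mid \lambda x.t \mid tu \mid \star \mid \langle t,u\rangle \mid \pi_{\mathtt l}(t) \mid \pi_{\mathtt r}(t)$. Types: $A,B ::= X \mid A\Rightarrow B \mid \forall X.A \mid \mathbf 1 \mid A\times B$. Typing rules: $\Delta,x:A\vdash_F x:A$; $\Delta\vdash_F\star:\mathbf 1$; from $\Delta,x:A\vdash_F t:B$ infer $\Delta\vdash_F\lambda x.t:A\Rightarrow B$; from $\Delta\vdash_F t:A\Rightarrow B$ and $\Delta\vdash_F u:A$ infer $\Delta\vdash_F tu:B$; from $\Delta\vdash_F t:A$ and $\Delta\vdash_F u:B$ infer $\Delta\vdash_F\langle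 t,u\rangle:A\times B$; from $\Delta\vdash_F t:A\times B$ infer $\Delta\vdash_F\pi_{\mathtt l}(t):A$ and $\Delta\vdash_F\pi_{\mathtt r}(t):B$; from $\Delta\vdash_F t:A$ with $X\notin FV(\Delta)$ infer $\Delta\vdash_F t:\forall X.A$; from $\Delta\vdash_F t:\forall X.A$ infer $\Delta\vdash_F t:A[B/X]$. Translation of types: $|X|=X$; $|\overline 0|=\mathbf 1$; $|\forall X.U|=\forall X.|U|$; $|U\to T|=|U|\Rightarrow|T|$; $|T+R|=|T|\times|R|$; extended pointwise to contexts. -}

module Defs where

open import Data.Nat using (ℕ; zero; suc; _+_)
open import Data.Fin using (Fin; zero; suc; _↑ʳ_)
open import Data.Vec using (Vec; []; _∷_; lookup; map)
open import Data.Vec.Functional using (Vector; init; last)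

infixl 7 _·_ _∙_
infixl 6 _∔_ _⊕_
infixr 6 _⇒_ _⇒F_
infixr 7 _×F_
infix  8 _[_] _[_]ᵁ _[_]* _[_]*ᵁ _[_]F
infix  4 _≋_ _≃_ _⊢_∶_ _⊢F_∶_

-- Both calculi use well-scoped de Bruijn indices, so that α-equivalence is
-- syntactic equality.  Throughout, m counts the term variables in scope and
-- n the type variables in scope.  The suffix F marks the syntax and typing of
-- System F with pairs.

data Term  (m : ℕ) : Set
data Value (m : ℕ) : Set

data Term m where
  val : Value m → Term m
  _·_ : Term m → Term m → Term m
  _∔_ : Term m → Term m → Term m
  𝟎   : Term m

data Value m where
  var : Fin m → Value m
  ƛ   : Term (suc m) → Value m

-- Terms are meant modulo this relation: typing is closed under it by the rule
-- ≋-conv, so that it is a property of equivalence classes.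

data _≋_ {m : ℕ} : Term m → Term m → Set where
  ≋-refl  : ∀ {t} → t ≋ t
  ≋-sym   : ∀ {t u} → t ≋ u → u ≋ t
  ≋-trans : ∀ {t u r} → t ≋ u → u ≋ r → t ≋ r
  ∔-comm  : ∀ {t u} → t ∔ u ≋ u ∔ t
  ∔-assoc : ∀ {t u r} → t ∔ (u ∔ r) ≋ (t ∔ u) ∔ r
  ƛ-cong  : ∀ {t t′ : Term (suc m)} → t ≋ t′ → val (ƛ t) ≋ val (ƛ t′)
  ·-cong  : ∀ {t t′ u u′} → t ≋ t′ → u ≋ u′ → t · u ≋ t′ · u′
  ∔-cong  : ∀ {t t′ u u′} → t ≋ t′ → u ≋ u′ → t ∔ u ≋ t′ ∔ u′

data Type     (n : ℕ) : Set
data UnitType (n : ℕ) : Set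

data Type n where
  unit : UnitType n → Type n
  _⊕_  : Type n → Type n → Type n
  𝟘    : Type n

data UnitType n where
  tvar : Fin n → UnitType n
  _⇒_  : UnitType n → Type n → UnitType n
  all  : UnitType (suc n) → UnitType n

liftR : ∀ {n k} → (Fin n → Fin k) → Fin (suc n) → Fin (suc k)
liftR ρ zero    = zero
liftR ρ (suc x) = suc (ρ x)

ren  : ∀ {n k} → (Fin n → Fin k) → Type n → Type k
renᵁ : ∀ {n k} → (Fin n → Fin k) → UnitType n → UnitType k

ren ρ (unit U) = unit (renᵁ ρ U)
ren ρ (T ⊕ R)  = ren ρ T ⊕ ren ρ R
ren ρ 𝟘        = 𝟘

renᵁ ρ (tvar x) = tvar (ρ x)
renᵁ ρ (U ⇒ T)  = renᵁ ρ U ⇒ ren ρ T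
renᵁ ρ (all U)  = all (renᵁ (liftR ρ) U)

liftS : ∀ {n k} → (Fin n → UnitType k) → Fin (suc n) → UnitType (suc k)
liftS σ zero    = tvar zero
liftS σ (suc x) = renᵁ suc (σ x)

sub  : ∀ {n k} → (Fin n → UnitType k) → Type n → Type k
subᵁ : ∀ {n k} → (Fin n → UnitType k) → UnitType n → UnitType k

sub σ (unit U) = unit (subᵁ σ U)
sub σ (T ⊕ R)  = sub σ T ⊕ sub σ R
sub σ 𝟘        = 𝟘

subᵁ σ (tvar x) = σ x
subᵁ σ (U ⇒ T)  = subᵁ σ U ⇒ sub σ T
subᵁ σ (all U)  = all (subᵁ (liftS σ) U)

single : ∀ {n} → UnitType n → Fin (suc n) → UnitType n
single V zero    = V
single V (suc x) = tvar x

_[_] : ∀ {n} → Type (suc n) → UnitType n → Type n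
T [ V ] = sub (single V) T

_[_]ᵁ : ∀ {n} → UnitType (suc n) → UnitType n → UnitType n
U [ V ]ᵁ = subᵁ (single V) U

-- T[V₁/X₁]⋯[Vₖ/Xₖ], where X₁ , … , Xₖ are the indices 0 , … , k - 1.
-- The weakening of Vⱼ expresses that Xᵢ is not free in Vⱼ for j < i.

_[_]* : ∀ {n k} → Type (k + n) → Vec (UnitType n) k → Type n
T [ [] ]*                    = T
_[_]* {k = suc k} T (V ∷ Vs) = (T [ renᵁ (k ↑ʳ_) V ]) [ Vs ]*

_[_]*ᵁ : ∀ {n k} → UnitType (k + n) → Vec (UnitType n) k → UnitType n
U [ [] ]*ᵁ                    = U
_[_]*ᵁ {k = suc k} U (V ∷ Vs) = (U [ renᵁ (k ↑ʳ_) V ]ᵁ) [ Vs ]*ᵁ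

-- ∀X⃗.U, binding the indices 0 , … , k - 1 (0 innermost).

all* : ∀ {n} (k : ℕ) → UnitType (k + n) → UnitType n
all* zero    U = U
all* (suc k) U = all* k (all U)

∑ : ∀ {n α} → Vector (Type n) α → Type n
∑ {α = zero}  T = 𝟘
∑ {α = suc α} T = ∑ (init T) ⊕ last T

-- Type equivalence.  It is a single relation on types: unit types are
-- related when they are related as types.

data _≃_ : ∀ {n} → Type n → Type n → Set where
  ≃-refl  : ∀ {n} {T : Type n} → T ≃ T
  ≃-sym   : ∀ {n} {T R : Type n} → T ≃ R → R ≃ T
  ≃-trans : ∀ {n} {T R S : Type n} → T ≃ R → R ≃ S → T ≃ S
  ⊕-comm  : ∀ {n} {T R : Type n} → T ⊕ R ≃ R ⊕ T
  ⊕-assoc : ∀ {n} {T R S : Type n} → T ⊕ (R ⊕ S) ≃ (T ⊕ R) ⊕ S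
  ⊕-unit  : ∀ {n} {T : Type n} → T ⊕ 𝟘 ≃ T
  ⊕-cong  : ∀ {n} {T T′ R R′ : Type n} → T ≃ T′ → R ≃ R′ → T ⊕ R ≃ T′ ⊕ R′
  ⇒-cong  : ∀ {n} {U U′ : UnitType n} {T T′ : Type n} →
            unit U ≃ unit U′ → T ≃ T′ → unit (U ⇒ T) ≃ unit (U′ ⇒ T′)
  all-cong : ∀ {n} {U U′ : UnitType (suc n)} →
            unit U ≃ unit U′ → unit (all U) ≃ unit (all U′)

Ctx : ℕ → ℕ → Set
Ctx n m = Vec (UnitType n) m

-- In ∀I the condition X ∉ FV(Γ) is expressed by weakening Γ.

data _⊢_∶_ {n m : ℕ} (Γ : Ctx n m) : Term m → Type n → Set where
  ax     : ∀ x → Γ ⊢ val (var x) ∶ unit (lookup Γ x)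
  ax𝟘    : Γ ⊢ 𝟎 ∶ 𝟘
  ≃-conv : ∀ {t T R} → Γ ⊢ t ∶ T → T ≃ R → Γ ⊢ t ∶ R
  ≋-conv : ∀ {t u T} → Γ ⊢ t ∶ T → t ≋ u → Γ ⊢ u ∶ T
  ⇒I     : ∀ {t U T} → (U ∷ Γ) ⊢ t ∶ T → Γ ⊢ val (ƛ t) ∶ unit (U ⇒ T)
  ⇒E     : ∀ {t u k α β} {U : UnitType (k + n)}
             {T : Vector (Type (k + n)) α} {V : Vector (Vec (UnitType n) k) β} →
           Γ ⊢ t ∶ ∑ (λ i → unit (all* k (U ⇒ T i))) →
           Γ ⊢ u ∶ ∑ (λ j → unit (U [ V j ]*ᵁ)) →
           Γ ⊢ t · u ∶ ∑ (λ i → ∑ (λ j → T i [ V j ]*))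
  ∔I     : ∀ {t u T R} → Γ ⊢ t ∶ T → Γ ⊢ u ∶ R → Γ ⊢ t ∔ u ∶ T ⊕ R
  ∀E     : ∀ {t U} (V : UnitType n) →
           Γ ⊢ t ∶ unit (all U) → Γ ⊢ t ∶ unit (U [ V ]ᵁ)
  ∀I     : ∀ {t U} → map (renᵁ suc) Γ ⊢ t ∶ unit U → Γ ⊢ t ∶ unit (all U)

data TermF (m : ℕ) : Set where
  var   : Fin m → TermF m
  ƛ     : TermF (suc m) → TermF m
  _∙_   : TermF m → TermF m → TermF m
  ⋆     : TermF m
  ⟨_,_⟩ : TermF m → TermF m → TermF m
  πˡ πʳ : TermF m → TermF m

data TypeF (n : ℕ) : Set where
  tvar : Fin n → TypeF n
  _⇒F_ : TypeF n → TypeF n → TypeF n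
  allF : TypeF (suc n) → TypeF n
  𝟏    : TypeF n
  _×F_ : TypeF n → TypeF n → TypeF n

renF : ∀ {n k} → (Fin n → Fin k) → TypeF n → TypeF k
renF ρ (tvar x) = tvar (ρ x)
renF ρ (A ⇒F B) = renF ρ A ⇒F renF ρ B
renF ρ (allF A) = allF (renF (liftR ρ) A)
renF ρ 𝟏        = 𝟏
renF ρ (A ×F B) = renF ρ A ×F renF ρ B

liftF : ∀ {n k} → (Fin n → TypeF k) → Fin (suc n) → TypeF (suc k)
liftF σ zero    = tvar zero
liftF σ (suc x) = renF suc (σ x)

subF : ∀ {n k} → (Fin n → TypeF k) → TypeF n → TypeF k
subF σ (tvar x) = σ x
subF σ (A ⇒F B) = subF σ A ⇒F subF σ B
subF σ (allF A) = allF (subF (liftF σ) A)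
subF σ 𝟏        = 𝟏
subF σ (A ×F B) = subF σ A ×F subF σ B

singleF : ∀ {n} → TypeF n → Fin (suc n) → TypeF n
singleF B zero    = B
singleF B (suc x) = tvar x

_[_]F : ∀ {n} → TypeF (suc n) → TypeF n → TypeF n
A [ B ]F = subF (singleF B) A

CtxF : ℕ → ℕ → Set
CtxF n m = Vec (TypeF n) m

data _⊢F_∶_ {n m : ℕ} (Δ : CtxF n m) : TermF m → TypeF n → Set where
  ax  : ∀ x → Δ ⊢F var x ∶ lookup Δ x
  𝟏I  : Δ ⊢F ⋆ ∶ 𝟏
  ⇒I  : ∀ {t A B} → (A ∷ Δ) ⊢F t ∶ B → Δ ⊢F ƛ t ∶ A ⇒F B
  ⇒E  : ∀ {t u A B} → Δ ⊢F t ∶ A ⇒F B → Δ ⊢F u ∶ A → Δ ⊢F t ∙ u ∶ B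
  ×I  : ∀ {t u A B} → Δ ⊢F t ∶ A → Δ ⊢F u ∶ B → Δ ⊢F ⟨ t , u ⟩ ∶ A ×F B
  ×Eˡ : ∀ {t A B} → Δ ⊢F t ∶ A ×F B → Δ ⊢F πˡ t ∶ A
  ×Eʳ : ∀ {t A B} → Δ ⊢F t ∶ A ×F B → Δ ⊢F πʳ t ∶ B
  ∀I  : ∀ {t A} → map (renF suc) Δ ⊢F t ∶ A → Δ ⊢F t ∶ allF A
  ∀E  : ∀ {t A} (B : TypeF n) → Δ ⊢F t ∶ allF A → Δ ⊢F t ∶ A [ B ]F

∣_∣  : ∀ {n} → Type n → TypeF n
∣_∣ᵁ : ∀ {n} → UnitType n → TypeF n

∣ unit U ∣ = ∣ U ∣ᵁ
∣ T ⊕ R ∣  = ∣ T ∣ ×F ∣ R ∣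
∣ 𝟘 ∣      = 𝟏

∣ tvar x ∣ᵁ = tvar x
∣ U ⇒ T ∣ᵁ  = ∣ U ∣ᵁ ⇒F ∣ T ∣
∣ all U ∣ᵁ  = allF ∣ U ∣ᵁ

∣_∣ᶜ : ∀ {n m} → Ctx n m → CtxF n m
∣ Γ ∣ᶜ = map ∣_∣ᵁ Γ

{-# OPTIONS --safe #-}
module Submission where

-- The conclusion only asks that |T| be inhabited in the context |Γ|, so the
-- proof is an induction on the additive derivation that tracks inhabitation
-- and forgets the additive term; conversion of terms is then trivial.
-- Coercions between types are provided in all contexts at once, so that no
-- weakening lemma for derivations of System F is needed.
--
-- * Equivalence of types (≃-coercions): if T ≃ R then |T| ⇒ |R| and
--   |R| ⇒ |T| are inhabited in every context.  Commutativity, associativity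
--   and the unit law are the usual maps between products; under an arrow one
--   composes on both sides, and under a quantifier one instantiates at the
--   fresh variable and generalises again.
--
-- * Elimination of arrows: |∑ T| is an iterated product, so inhabiting it
--   amounts to inhabiting every |T i| (∑-intro, ∑-elim).  The i-th component
--   of the function, instantiated at the types V j (all*-elim), is applied to
--   the j-th component of the argument, and the results are tupled.
--
-- The remaining work is that the translation commutes with renaming and with
-- simple and iterated substitution (∣ren∣, ∣sub∣, ∣inst*∣).

open import Data.Product using (_×_; _,_; proj₁; swap; ∃-syntax)
open import Data.Nat using (ℕ; zero; suc; _+_)
open import Data.Fin using (Fin; zero; suc; _↑ʳ_; inject₁; fromℕ)
open import Data.Fin.Relation.Unary.Top using (view; ‵fromℕ; ‵inject₁)
open import Data.Vec using (Vec; []; _∷_; lookup; map)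
open import Data.Vec.Properties using (lookup-map; map-∘; map-cong)
open import Data.Vec.Functional using (Vector; init)
open import Function using (_∘_)
open import Relation.Binary.PropositionalEquality
  using (_≡_; _≗_; refl; sym; trans; cong; cong₂; subst; module ≡-Reasoning)
open import Defs

private
  variable
    n k l m : ℕ

-- Renaming and substitution in the types of System F

liftR-∘ : (ρ : Fin k → Fin l) (ξ : Fin n → Fin k) →
          liftR ρ ∘ liftR ξ ≗ liftR (ρ ∘ ξ)
liftR-∘ ρ ξ zero    = refl
liftR-∘ ρ ξ (suc x) = refl

renF-cong : {ρ ξ : Fin n → Fin k} → ρ ≗ ξ → renF ρ ≗ renF ξ
renF-cong e (tvar x) = cong tvar (e x)
renF-cong e (A ⇒F B) = cong₂ _⇒F_ (renF-cong e A) (renF-cong e B)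
renF-cong e (allF A) =
  cong allF (renF-cong (λ { zero → refl ; (suc x) → cong suc (e x) }) A)
renF-cong e 𝟏        = refl
renF-cong e (A ×F B) = cong₂ _×F_ (renF-cong e A) (renF-cong e B)

subF-cong : {σ τ : Fin n → TypeF k} → σ ≗ τ → subF σ ≗ subF τ
subF-cong e (tvar x) = e x
subF-cong e (A ⇒F B) = cong₂ _⇒F_ (subF-cong e A) (subF-cong e B)
subF-cong e (allF A) =
  cong allF (subF-cong (λ { zero → refl ; (suc x) → cong (renF suc) (e x) }) A)
subF-cong e 𝟏        = refl
subF-cong e (A ×F B) = cong₂ _×F_ (subF-cong e A) (subF-cong e B)

subF-id : (A : TypeF n) → subF tvar A ≡ A
subF-id (tvar x) = refl
subF-id (A ⇒F B) = cong₂ _⇒F_ (subF-id A) (subF-id B)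
subF-id (allF A) =
  cong allF (trans (subF-cong (λ { zero → refl ; (suc x) → refl }) A)
                   (subF-id A))
subF-id 𝟏        = refl
subF-id (A ×F B) = cong₂ _×F_ (subF-id A) (subF-id B)

renF-renF : (ρ : Fin k → Fin l) (ξ : Fin n → Fin k) →
            renF ρ ∘ renF ξ ≗ renF (ρ ∘ ξ)
renF-renF ρ ξ (tvar x) = refl
renF-renF ρ ξ (A ⇒F B) = cong₂ _⇒F_ (renF-renF ρ ξ A) (renF-renF ρ ξ B)
renF-renF ρ ξ (allF A) =
  cong allF (trans (renF-renF (liftR ρ) (liftR ξ) A)
                   (renF-cong (liftR-∘ ρ ξ) A))
renF-renF ρ ξ 𝟏        = refl
renF-renF ρ ξ (A ×F B) = cong₂ _×F_ (renF-renF ρ ξ A) (renF-renF ρ ξ B)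

subF-renF : (σ : Fin k → TypeF l) (ρ : Fin n → Fin k) →
            subF σ ∘ renF ρ ≗ subF (σ ∘ ρ)
subF-renF σ ρ (tvar x) = refl
subF-renF σ ρ (A ⇒F B) = cong₂ _⇒F_ (subF-renF σ ρ A) (subF-renF σ ρ B)
subF-renF σ ρ (allF A) =
  cong allF (trans (subF-renF (liftF σ) (liftR ρ) A)
                   (subF-cong (λ { zero → refl ; (suc x) → refl }) A))
subF-renF σ ρ 𝟏        = refl
subF-renF σ ρ (A ×F B) = cong₂ _×F_ (subF-renF σ ρ A) (subF-renF σ ρ B)

renF-subF : (ρ : Fin k → Fin l) (σ : Fin n → TypeF k) →
            renF ρ ∘ subF σ ≗ subF (renF ρ ∘ σ)
renF-subF ρ σ (tvar x) = refl
renF-subF ρ σ (A ⇒F B) = cong₂ _⇒F_ (renF-subF ρ σ A) (renF-subF ρ σ B)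
renF-subF ρ σ (allF A) =
  cong allF (trans (renF-subF (liftR ρ) (liftF σ) A) (subF-cong lifts A))
  where
  lifts : renF (liftR ρ) ∘ liftF σ ≗ liftF (renF ρ ∘ σ)
  lifts zero    = refl
  lifts (suc x) = trans (renF-renF (liftR ρ) suc (σ x))
                        (sym (renF-renF suc ρ (σ x)))
renF-subF ρ σ 𝟏        = refl
renF-subF ρ σ (A ×F B) = cong₂ _×F_ (renF-subF ρ σ A) (renF-subF ρ σ B)

subF-subF : (τ : Fin k → TypeF l) (σ : Fin n → TypeF k) →
            subF τ ∘ subF σ ≗ subF (subF τ ∘ σ)
subF-subF τ σ (tvar x) = refl
subF-subF τ σ (A ⇒F B) = cong₂ _⇒F_ (subF-subF τ σ A) (subF-subF τ σ B)
subF-subF τ σ (allF A) =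
  cong allF (trans (subF-subF (liftF τ) (liftF σ) A) (subF-cong lifts A))
  where
  lifts : subF (liftF τ) ∘ liftF σ ≗ liftF (subF τ ∘ σ)
  lifts zero    = refl
  lifts (suc x) = trans (subF-renF (liftF τ) suc (σ x))
                        (sym (renF-subF suc τ (σ x)))
subF-subF τ σ 𝟏        = refl
subF-subF τ σ (A ×F B) = cong₂ _×F_ (subF-subF τ σ A) (subF-subF τ σ B)

weaken-[]F : (A B : TypeF n) → renF suc A [ B ]F ≡ A
weaken-[]F A B = trans (subF-renF (singleF B) suc A) (subF-id A)

-- Instantiating a weakened quantifier body at the freshly bound variable.
fresh-[]F : (A : TypeF (suc n)) → renF (liftR suc) A [ tvar zero ]F ≡ A
fresh-[]F A = begin
  renF (liftR suc) A [ tvar zero ]F              ≡⟨ subF-renF _ (liftR suc) A ⟩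
  subF (singleF (tvar zero) ∘ liftR suc) A       ≡⟨ subF-cong (λ { zero → refl ; (suc x) → refl }) A ⟩
  subF tvar A                                    ≡⟨ subF-id A ⟩
  A                                              ∎
  where open ≡-Reasoning

-- The translation commutes with renaming and substitution

∣ren∣  : (ρ : Fin n → Fin k) (T : Type n) → ∣ ren ρ T ∣ ≡ renF ρ ∣ T ∣
∣renᵁ∣ : (ρ : Fin n → Fin k) (U : UnitType n) → ∣ renᵁ ρ U ∣ᵁ ≡ renF ρ ∣ U ∣ᵁ

∣ren∣ ρ (unit U) = ∣renᵁ∣ ρ U
∣ren∣ ρ (T ⊕ R)  = cong₂ _×F_ (∣ren∣ ρ T) (∣ren∣ ρ R)
∣ren∣ ρ 𝟘        = refl

∣renᵁ∣ ρ (tvar x) = refl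
∣renᵁ∣ ρ (U ⇒ T)  = cong₂ _⇒F_ (∣renᵁ∣ ρ U) (∣ren∣ ρ T)
∣renᵁ∣ ρ (all U)  = cong allF (∣renᵁ∣ (liftR ρ) U)

∣liftS∣ : (σ : Fin n → UnitType k) → ∣_∣ᵁ ∘ liftS σ ≗ liftF (∣_∣ᵁ ∘ σ)
∣liftS∣ σ zero    = refl
∣liftS∣ σ (suc x) = ∣renᵁ∣ suc (σ x)

∣sub∣  : (σ : Fin n → UnitType k) (T : Type n) →
         ∣ sub σ T ∣ ≡ subF (∣_∣ᵁ ∘ σ) ∣ T ∣
∣subᵁ∣ : (σ : Fin n → UnitType k) (U : UnitType n) →
         ∣ subᵁ σ U ∣ᵁ ≡ subF (∣_∣ᵁ ∘ σ) ∣ U ∣ᵁ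

∣sub∣ σ (unit U) = ∣subᵁ∣ σ U
∣sub∣ σ (T ⊕ R)  = cong₂ _×F_ (∣sub∣ σ T) (∣sub∣ σ R)
∣sub∣ σ 𝟘        = refl

∣subᵁ∣ σ (tvar x) = refl
∣subᵁ∣ σ (U ⇒ T)  = cong₂ _⇒F_ (∣subᵁ∣ σ U) (∣sub∣ σ T)
∣subᵁ∣ σ (all U)  =
  cong allF (trans (∣subᵁ∣ (liftS σ) U) (subF-cong (∣liftS∣ σ) ∣ U ∣ᵁ))

∣inst∣ : (T : Type (suc n)) (V : UnitType n) → ∣ T [ V ] ∣ ≡ ∣ T ∣ [ ∣ V ∣ᵁ ]F
∣inst∣ T V = trans (∣sub∣ (single V) T)
                   (subF-cong (λ { zero → refl ; (suc x) → refl }) ∣ T ∣)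

∣weaken∣ᶜ : (Γ : Ctx n m) → ∣ map (renᵁ suc) Γ ∣ᶜ ≡ map (renF suc) ∣ Γ ∣ᶜ
∣weaken∣ᶜ Γ = begin
  map ∣_∣ᵁ (map (renᵁ suc) Γ)   ≡⟨ map-∘ ∣_∣ᵁ (renᵁ suc) Γ ⟨
  map (∣_∣ᵁ ∘ renᵁ suc) Γ       ≡⟨ map-cong (∣renᵁ∣ suc) Γ ⟩
  map (renF suc ∘ ∣_∣ᵁ) Γ       ≡⟨ map-∘ (renF suc) ∣_∣ᵁ Γ ⟩
  map (renF suc) (map ∣_∣ᵁ Γ)   ∎
  where open ≡-Reasoning

-- Iterated instantiation

-- The parallel substitution replacing the first k indices by the translations
-- of the given types and lowering the others by k.  The iterated substitution
-- of the additive types translates to it.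
multi : Vec (UnitType n) k → Fin (k + n) → TypeF n
multi []       x       = tvar x
multi (V ∷ Vs) zero    = ∣ V ∣ᵁ
multi (V ∷ Vs) (suc x) = multi Vs x

multi-↑ʳ : (Vs : Vec (UnitType n) k) (x : Fin n) → multi Vs (k ↑ʳ x) ≡ tvar x
multi-↑ʳ []       x = refl
multi-↑ʳ (V ∷ Vs) x = multi-↑ʳ Vs x

multi-weaken : (Vs : Vec (UnitType n) k) (V : UnitType n) →
               subF (multi Vs) ∣ renᵁ (k ↑ʳ_) V ∣ᵁ ≡ ∣ V ∣ᵁ
multi-weaken {k = k} Vs V = begin
  subF (multi Vs) ∣ renᵁ (k ↑ʳ_) V ∣ᵁ      ≡⟨ cong (subF (multi Vs)) (∣renᵁ∣ (k ↑ʳ_) V) ⟩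
  subF (multi Vs) (renF (k ↑ʳ_) ∣ V ∣ᵁ)    ≡⟨ subF-renF (multi Vs) (k ↑ʳ_) ∣ V ∣ᵁ ⟩
  subF (multi Vs ∘ (k ↑ʳ_)) ∣ V ∣ᵁ         ≡⟨ subF-cong (multi-↑ʳ Vs) ∣ V ∣ᵁ ⟩
  subF tvar ∣ V ∣ᵁ                         ≡⟨ subF-id ∣ V ∣ᵁ ⟩
  ∣ V ∣ᵁ                                   ∎
  where open ≡-Reasoning

∣inst*∣ : (T : Type (k + n)) (Vs : Vec (UnitType n) k) →
          ∣ T [ Vs ]* ∣ ≡ subF (multi Vs) ∣ T ∣
∣inst*∣ T []       = sym (subF-id ∣ T ∣)
∣inst*∣ {k = suc k} T (V ∷ Vs) = begin
  ∣ (T [ V′ ]) [ Vs ]* ∣                        ≡⟨ ∣inst*∣ (T [ V′ ]) Vs ⟩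
  subF (multi Vs) ∣ T [ V′ ] ∣                  ≡⟨ cong (subF (multi Vs)) (∣inst∣ T V′) ⟩
  subF (multi Vs) (∣ T ∣ [ ∣ V′ ∣ᵁ ]F)          ≡⟨ subF-subF (multi Vs) (singleF ∣ V′ ∣ᵁ) ∣ T ∣ ⟩
  subF (subF (multi Vs) ∘ singleF ∣ V′ ∣ᵁ) ∣ T ∣ ≡⟨ subF-cong pointwise ∣ T ∣ ⟩
  subF (multi (V ∷ Vs)) ∣ T ∣                   ∎
  where
  open ≡-Reasoning
  V′ = renᵁ (k ↑ʳ_) V
  pointwise : subF (multi Vs) ∘ singleF ∣ V′ ∣ᵁ ≗ multi (V ∷ Vs)
  pointwise zero    = multi-weaken Vs V
  pointwise (suc x) = refl

unit-[]* : (U : UnitType (k + n)) (Vs : Vec (UnitType n) k) →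
           unit U [ Vs ]* ≡ unit (U [ Vs ]*ᵁ)
unit-[]* U []       = refl
unit-[]* {k = suc k} U (V ∷ Vs) = unit-[]* (U [ renᵁ (k ↑ʳ_) V ]ᵁ) Vs

∣inst*ᵁ∣ : (U : UnitType (k + n)) (Vs : Vec (UnitType n) k) →
           ∣ U [ Vs ]*ᵁ ∣ᵁ ≡ subF (multi Vs) ∣ U ∣ᵁ
∣inst*ᵁ∣ U Vs = trans (cong ∣_∣ (sym (unit-[]* U Vs))) (∣inst*∣ (unit U) Vs)

-- Instantiating the innermost quantifier after the outer ones.
lift-multi : (V : UnitType n) (Vs : Vec (UnitType n) k) (A : TypeF (suc (k + n))) →
             subF (liftF (multi Vs)) A [ ∣ V ∣ᵁ ]F ≡ subF (multi (V ∷ Vs)) A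
lift-multi V Vs A =
  trans (subF-subF (singleF ∣ V ∣ᵁ) (liftF (multi Vs)) A) (subF-cong pointwise A)
  where
  pointwise : subF (singleF ∣ V ∣ᵁ) ∘ liftF (multi Vs) ≗ multi (V ∷ Vs)
  pointwise zero    = refl
  pointwise (suc x) = weaken-[]F (multi Vs x) ∣ V ∣ᵁ

all*-elim : {Δ : CtxF n m} {t : TermF m} (W : UnitType (k + n))
            (Vs : Vec (UnitType n) k) →
            Δ ⊢F t ∶ ∣ all* k W ∣ᵁ → Δ ⊢F t ∶ subF (multi Vs) ∣ W ∣ᵁ
all*-elim W []       d = subst (_ ⊢F _ ∶_) (sym (subF-id ∣ W ∣ᵁ)) d
all*-elim W (V ∷ Vs) d =
  subst (_ ⊢F _ ∶_) (lift-multi V Vs ∣ W ∣ᵁ) (∀E ∣ V ∣ᵁ (all*-elim (all W) Vs d))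

-- Inhabitation in System F

infix 4 _⊩_

-- A is inhabited in the context Δ.
_⊩_ : CtxF n m → TypeF n → Set
Δ ⊩ A = ∃[ t ] (Δ ⊢F t ∶ A)

⊩-lam : {Δ : CtxF n m} {A B : TypeF n} → A ∷ Δ ⊩ B → Δ ⊩ A ⇒F B
⊩-lam (_ , d) = _ , ⇒I d

⊩-app : {Δ : CtxF n m} {A B : TypeF n} → Δ ⊩ A ⇒F B → Δ ⊩ A → Δ ⊩ B
⊩-app (_ , d) (_ , e) = _ , ⇒E d e

⊩-pair : {Δ : CtxF n m} {A B : TypeF n} → Δ ⊩ A → Δ ⊩ B → Δ ⊩ A ×F B
⊩-pair (_ , d) (_ , e) = _ , ×I d e

⊩-fst : {Δ : CtxF n m} {A B : TypeF n} → Δ ⊩ A ×F B → Δ ⊩ A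
⊩-fst (_ , d) = _ , ×Eˡ d

⊩-snd : {Δ : CtxF n m} {A B : TypeF n} → Δ ⊩ A ×F B → Δ ⊩ B
⊩-snd (_ , d) = _ , ×Eʳ d

⊩-gen : {Δ : CtxF n m} {A : TypeF (suc n)} → map (renF suc) Δ ⊩ A → Δ ⊩ allF A
⊩-gen (_ , d) = _ , ∀I d

⊩-inst : {Δ : CtxF n m} {A : TypeF (suc n)} (B : TypeF n) →
         Δ ⊩ allF A → Δ ⊩ A [ B ]F
⊩-inst B (_ , d) = _ , ∀E B d

⊩-var : {Δ : CtxF n m} (x : Fin m) → Δ ⊩ lookup Δ x
⊩-var x = _ , ax x

∑-intro : {Δ : CtxF n m} (α : ℕ) (T : Vector (Type n) α) →
          (∀ i → Δ ⊩ ∣ T i ∣) → Δ ⊩ ∣ ∑ T ∣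
∑-intro zero    T h = ⋆ , 𝟏I
∑-intro (suc α) T h = ⊩-pair (∑-intro α (init T) (h ∘ inject₁)) (h (fromℕ α))

∑-elim : {Δ : CtxF n m} (α : ℕ) (T : Vector (Type n) α) →
         Δ ⊩ ∣ ∑ T ∣ → ∀ i → Δ ⊩ ∣ T i ∣
∑-elim (suc α) T h i with view i
... | ‵fromℕ     = ⊩-snd h
... | ‵inject₁ j = ∑-elim α (init T) (⊩-fst h) j

-- Equivalent types are interchangeable

infix 4 _↪_ _↭_

-- A ⇒ B is inhabited in every context.  Asking for all contexts, rather than
-- for a closed term, makes coercions usable under binders without weakening.
_↪_ : TypeF n → TypeF n → Set
A ↪ B = ∀ {m} (Δ : CtxF _ m) → Δ ⊩ A ⇒F B

-- Mutual coercibility; the two maps need not be inverse to each other.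
_↭_ : TypeF n → TypeF n → Set
A ↭ B = (A ↪ B) × (B ↪ A)

↪-trans : {A B C : TypeF n} → A ↪ B → B ↪ C → A ↪ C
↪-trans f g Δ = ⊩-lam (⊩-app (g _) (⊩-app (f _) (⊩-var zero)))

×-mono : {A A′ B B′ : TypeF n} → A ↪ A′ → B ↪ B′ → A ×F B ↪ A′ ×F B′
×-mono f g Δ = ⊩-lam (⊩-pair (⊩-app (f _) (⊩-fst (⊩-var zero)))
                             (⊩-app (g _) (⊩-snd (⊩-var zero))))

⇒-mono : {A A′ B B′ : TypeF n} → A′ ↪ A → B ↪ B′ → A ⇒F B ↪ A′ ⇒F B′
⇒-mono f g Δ =
  ⊩-lam (⊩-lam (⊩-app (g _)
    (⊩-app (⊩-var (suc zero)) (⊩-app (f _) (⊩-var zero)))))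

-- Under the binder, the hypothesis is instantiated at the bound variable.
all-mono : {A B : TypeF (suc n)} → A ↪ B → allF A ↪ allF B
all-mono {A = A} f Δ =
  ⊩-lam (⊩-gen (⊩-app (f _)
    (subst (map (renF suc) (allF A ∷ Δ) ⊩_) (fresh-[]F A)
      (⊩-inst {A = renF (liftR suc) A} (tvar zero) (⊩-var zero)))))

×-swap : (A B : TypeF n) → A ×F B ↪ B ×F A
×-swap A B Δ = ⊩-lam (⊩-pair (⊩-snd (⊩-var zero)) (⊩-fst (⊩-var zero)))

×-assocˡ : (A B C : TypeF n) → A ×F (B ×F C) ↪ (A ×F B) ×F C
×-assocˡ A B C Δ =
  ⊩-lam (⊩-pair (⊩-pair (⊩-fst (⊩-var zero)) (⊩-fst (⊩-snd (⊩-var zero))))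
                (⊩-snd (⊩-snd (⊩-var zero))))

×-assocʳ : (A B C : TypeF n) → (A ×F B) ×F C ↪ A ×F (B ×F C)
×-assocʳ A B C Δ =
  ⊩-lam (⊩-pair (⊩-fst (⊩-fst (⊩-var zero)))
                (⊩-pair (⊩-snd (⊩-fst (⊩-var zero))) (⊩-snd (⊩-var zero))))

-- Both directions are needed at once, since ≃ is closed under symmetry and
-- arrows are contravariant in their domain.
≃-coercions : {T R : Type n} → T ≃ R → ∣ T ∣ ↭ ∣ R ∣
≃-coercions ≃-refl          = (λ Δ → ⊩-lam (⊩-var zero)) , (λ Δ → ⊩-lam (⊩-var zero))
≃-coercions (≃-sym e)       = swap (≃-coercions e)
≃-coercions (≃-trans e e′)  =
  let (f , f⁻¹) = ≃-coercions e ; (g , g⁻¹) = ≃-coercions e′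
  in ↪-trans f g , ↪-trans g⁻¹ f⁻¹
≃-coercions ⊕-comm          = ×-swap _ _ , ×-swap _ _
≃-coercions ⊕-assoc         = ×-assocˡ _ _ _ , ×-assocʳ _ _ _
≃-coercions ⊕-unit          =
  (λ Δ → ⊩-lam (⊩-fst (⊩-var zero))) ,
  (λ Δ → ⊩-lam (⊩-pair (⊩-var zero) (⋆ , 𝟏I)))
≃-coercions (⊕-cong e e′)   =
  let (f , f⁻¹) = ≃-coercions e ; (g , g⁻¹) = ≃-coercions e′
  in ×-mono f g , ×-mono f⁻¹ g⁻¹
≃-coercions (⇒-cong e e′)   =
  let (f , f⁻¹) = ≃-coercions e ; (g , g⁻¹) = ≃-coercions e′
  in ⇒-mono f⁻¹ g , ⇒-mono f g⁻¹
≃-coercions (all-cong e)    =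
  let (f , f⁻¹) = ≃-coercions e in all-mono f , all-mono f⁻¹

-- The translation of derivations

-- One function component applied to one argument component, both at the
-- types Vs.
apply-inst : {Δ : CtxF n m} (U : UnitType (k + n)) (T : Type (k + n))
             (Vs : Vec (UnitType n) k) →
             Δ ⊩ ∣ all* k (U ⇒ T) ∣ᵁ → Δ ⊩ ∣ U [ Vs ]*ᵁ ∣ᵁ → Δ ⊩ ∣ T [ Vs ]* ∣
apply-inst U T Vs (_ , d) h =
  subst (_ ⊩_) (sym (∣inst*∣ T Vs))
    (⊩-app (_ , all*-elim (U ⇒ T) Vs d) (subst (_ ⊩_) (∣inst*ᵁ∣ U Vs) h))

⊢⇒⊩ : {Γ : Ctx n m} {t : Term m} {T : Type n} → Γ ⊢ t ∶ T → ∣ Γ ∣ᶜ ⊩ ∣ T ∣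
⊢⇒⊩ {Γ = Γ} (ax x) = subst (_ ⊩_) (lookup-map x ∣_∣ᵁ Γ) (⊩-var x)
⊢⇒⊩ ax𝟘            = ⋆ , 𝟏I
⊢⇒⊩ (≃-conv d e)   = ⊩-app (proj₁ (≃-coercions e) _) (⊢⇒⊩ d)
⊢⇒⊩ (≋-conv d _)   = ⊢⇒⊩ d
⊢⇒⊩ (⇒I d)         = ⊩-lam (⊢⇒⊩ d)
⊢⇒⊩ (⇒E {k = k} {α = α} {β = β} {U = U} {T = T} {V = V} d e) =
  ∑-intro α _ λ i → ∑-intro β _ λ j →
    apply-inst U (T i) (V j)
      (∑-elim α (λ i → unit (all* k (U ⇒ T i))) (⊢⇒⊩ d) i)
      (∑-elim β (λ j → unit (U [ V j ]*ᵁ)) (⊢⇒⊩ e) j)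
⊢⇒⊩ (∔I d e)       = ⊩-pair (⊢⇒⊩ d) (⊢⇒⊩ e)
⊢⇒⊩ (∀E {U = U} V d) =
  subst (_ ⊩_) (sym (∣inst∣ (unit U) V)) (⊩-inst ∣ V ∣ᵁ (⊢⇒⊩ d))
⊢⇒⊩ {Γ = Γ} (∀I d) = ⊩-gen (subst (_⊩ _) (∣weaken∣ᶜ Γ) (⊢⇒⊩ d))

theorem17 : ∀ {n m : ℕ} (Γ : Ctx n m) (t : Term m) (T : Type n) →
    Γ ⊢ t ∶ T → ∃[ t′ ] (∣ Γ ∣ᶜ ⊢F t′ ∶ ∣ T ∣)
theorem17 Γ t T d = ⊢⇒⊩ d
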